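{- For any $0<\varepsilon<1/2$ and any real $1\le R<(\varepsilon^{ -1}-1)/4$, there are two weighted graphs $G$ and $G'$ such that, for every family $\mathcal I=\{[\ell_i,r_i]\}_i$ of intervals $[\ell_i,r_i]\subseteq\mathbb R_{>0}$ satisfying $r_i/\ell_i\le R$ for every $i$, we have $\mu_w(G[\ell_i,r_i])=\mu_w(G'[\ell_i,r_i])$ for every $i$, but no value is a $(1\pm\varepsilon)$-approximation of both $\mu_w(G)$ and $\mu_w(G')$.
   Context: Weighted graphs have positive real edge weights. $\mu_w(F)$ is the maximum weight of a matching in a weighted graph $F$ (zero if $F$ has no edges). $G[\ell,r]$ is the subgraph of $G$ that contains all edges of $G$ with weights in $[\ell,r]$. A value $\nu$ is a $(1\pm\varepsilon)$-approximation of $x$ if $|\nu-x|\le\varepsilon x$. -}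

module Defs where

open import Algebra.Bundles using (CommutativeRing)
open import Data.Fin.Base using (Fin; _<_)
open import Data.Fin.Properties using (_≟_)
open import Data.List.Base using (List; []; _∷_; _++_; map; filter; foldr)
import Data.List.Extrema as Extrema
open import Data.List.Relation.Unary.AllPairs using (AllPairs; allPairs?)
open import Data.List.Relation.Unary.AllPairs.Properties using (filter⁺)
open import Data.Nat.Base using (ℕ)
open import Data.Product.Base using (∃; _×_)
open import Level using (Level; suc; _⊔_)
open import Relation.Binary.Bundles using (TotalOrder)
open import Relation.Binary.Core using (Rel)
import Relation.Binary.Construct.NonStrictToStrict as ToStrict
open import Relation.Binary.Definitions using (Decidable)
open import Relation.Binary.PropositionalEquality using (_≡_; _≢_)
open import Relation.Binary.Structures using (IsDecTotalOrder)
open import Relation.Nullary using (¬_; Dec; ¬?; _×-dec_)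
import Algebra.Construct.NaturalChoice.Max as Max

-- The classical axioms of ℝ, which determine it up to isomorphism: an ordered
-- field in which every inhabited set that is bounded above has a supremum.
-- As in classical mathematics the order is decidable.
record RealNumbers (c ℓ₁ ℓ₂ : Level) : Set (suc (c ⊔ ℓ₁ ⊔ ℓ₂)) where
  field
    commutativeRing : CommutativeRing c ℓ₁

  open CommutativeRing commutativeRing public

  infix 4 _≤_
  infix 9 _⁻¹

  -- _⁻¹ is total, but nothing is assumed about 0# ⁻¹.
  field
    _≤_             : Rel Carrier ℓ₂
    isDecTotalOrder : IsDecTotalOrder _≈_ _≤_
    0≉1             : ¬ (0# ≈ 1#)
    _⁻¹             : Carrier → Carrier
    ⁻¹-inverse      : ∀ x → ¬ (x ≈ 0#) → x * x ⁻¹ ≈ 1#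
    +-monoʳ-≤       : ∀ z {x y} → x ≤ y → z + x ≤ z + y
    *-nonNegative   : ∀ {x y} → 0# ≤ x → 0# ≤ y → 0# ≤ x * y

  UpperBound : (Carrier → Set (c ⊔ ℓ₁ ⊔ ℓ₂)) → Carrier → Set (c ⊔ ℓ₁ ⊔ ℓ₂)
  UpperBound P b = ∀ x → P x → x ≤ b

  field
    supremum : (P : Carrier → Set (c ⊔ ℓ₁ ⊔ ℓ₂)) → ∃ P → ∃ (UpperBound P) →
               ∃ λ s → UpperBound P s × (∀ b → UpperBound P b → s ≤ b)

  open IsDecTotalOrder isDecTotalOrder public using (_≤?_; isTotalOrder)

  totalOrder : TotalOrder c ℓ₁ ℓ₂
  totalOrder = record { isTotalOrder = isTotalOrder }

  open ToStrict _≈_ _≤_ public using () renaming (_<_ to _<ᵣ_)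

  infixl 7 _/_
  _/_ : Carrier → Carrier → Carrier
  x / y = x * y ⁻¹

  2# 4# : Carrier
  2# = 1# + 1#
  4# = 2# + 2#

  abs : Carrier → Carrier
  abs x = Max._⊔_ totalOrder x (- x)

sublists : ∀ {a} {A : Set a} → List A → List (List A)
sublists []       = [] ∷ []
sublists (x ∷ xs) = sublists xs ++ map (x ∷_) (sublists xs)

module WeightedGraphs {c ℓ₁ ℓ₂ : Level} (ℝ : RealNumbers c ℓ₁ ℓ₂) where
  open RealNumbers ℝ

  -- An undirected edge is stored with its smaller endpoint first.
  record Edge (n : ℕ) : Set (c ⊔ ℓ₁ ⊔ ℓ₂) where
    field
      src tgt  : Fin n
      src<tgt  : src < tgt
      weight   : Carrier
      positive : 0# <ᵣ weight

  open Edge public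

  NotParallel : ∀ {n} → Rel (Edge n) _
  NotParallel e f = ¬ (src e ≡ src f × tgt e ≡ tgt f)

  record WeightedGraph : Set (c ⊔ ℓ₁ ⊔ ℓ₂) where
    field
      order  : ℕ
      edges  : List (Edge order)
      simple : AllPairs NotParallel edges

  open WeightedGraph public

  Disjoint : ∀ {n} → Rel (Edge n) _
  Disjoint e f =
    (src e ≢ src f × src e ≢ tgt f) × (tgt e ≢ src f × tgt e ≢ tgt f)

  disjoint? : ∀ {n} → Decidable (Disjoint {n})
  disjoint? e f =
    (¬? (src e ≟ src f) ×-dec ¬? (src e ≟ tgt f)) ×-dec
    (¬? (tgt e ≟ src f) ×-dec ¬? (tgt e ≟ tgt f))

  matchings : (G : WeightedGraph) → List (List (Edge (order G)))
  matchings G = filter (allPairs? disjoint?) (sublists (edges G))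

  totalWeight : ∀ {n} → List (Edge n) → Carrier
  totalWeight = foldr (λ e s → weight e + s) 0#

  -- The default value 0# is the weight of the empty matching.
  μ : WeightedGraph → Carrier
  μ G = Extrema.max totalOrder 0# (map totalWeight (matchings G))

  record Interval : Set (c ⊔ ℓ₁ ⊔ ℓ₂) where
    field
      lo hi : Carrier
      0<lo  : 0# <ᵣ lo
      lo≤hi : lo ≤ hi

  open Interval public

  WeightIn : ∀ {n} → Interval → Edge n → Set ℓ₂
  WeightIn I e = lo I ≤ weight e × weight e ≤ hi I

  weightIn? : ∀ {n} (I : Interval) (e : Edge n) → Dec (WeightIn I e)
  weightIn? I e = (lo I ≤? weight e) ×-dec (weight e ≤? hi I)

  infix 10 _[_]
  _[_] : WeightedGraph → Interval → WeightedGraph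
  G [ I ] = record
    { order  = order G
    ; edges  = filter (weightIn? I) (edges G)
    ; simple = filter⁺ (weightIn? I) (simple G)
    }

  Approximates : Carrier → Carrier → Carrier → Set ℓ₂
  Approximates ε ν x = abs (ν - x) ≤ ε * x

{-# OPTIONS --safe #-}

-- With w = 2R, let G be two disjoint edges of weights 1 and w, and let G′ be a
-- path with the same two weights.  An interval of ratio at most R contains at
-- most one of 1 and w, so it cannot tell G from G′; but μ G = w + 1 and
-- μ G′ = w.  A common approximation would give 1 ≤ ε (2w + 1) = ε (4R + 1),
-- whereas the bound on R says exactly that ε (4R + 1) < 1.
module Submission where

open import Defs
open import Level using (Level)
open import Data.Product.Base using (∃; _×_; _,_; proj₁; proj₂)
open import Relation.Nullary using (¬_; yes; no)
import Algebra.Construct.NaturalChoice.Max as Max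
import Algebra.Properties.AbelianGroup as AbelianGroupProperties
import Algebra.Properties.Ring as RingProperties
import Algebra.Solver.Ring.NaturalCoefficients.Default as SemiringSolver
open import Data.Empty using (⊥-elim)
open import Data.Fin.Patterns using (0F; 1F; 2F; 3F)
open import Data.List.Base using ([]; _∷_; map)
open import Data.List.Membership.Propositional using (_∈_; lose)
import Data.List.Extrema as Extrema
open import Data.List.Relation.Unary.All using (All; []; _∷_)
import Data.List.Relation.Unary.All.Properties as All
open import Data.List.Relation.Unary.AllPairs using ([]; _∷_)
open import Data.List.Relation.Unary.Any using (here; there)
import Data.List.Relation.Unary.Any.Properties as Any
open import Data.Nat.Base using (z≤n; s≤s)
open import Data.Sum.Base using (inj₁; inj₂)
open import Relation.Binary.Bundles using (TotalOrder)
import Relation.Binary.Construct.NonStrictToStrict as ToStrict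
import Relation.Binary.PropositionalEquality as ≡
import Relation.Binary.Reasoning.PartialOrder as PartialOrderReasoning

-- Arithmetic of an ordered field, derived from the axioms.

module OrderedField {c ℓ₁ ℓ₂ : Level} (ℝ : RealNumbers c ℓ₁ ℓ₂) where
  open RealNumbers ℝ
  open TotalOrder totalOrder public
    using (poset; antisym; total)
    renaming (refl to ≤-refl; reflexive to ≤-reflexive; trans to ≤-trans)
  open PartialOrderReasoning poset
  open RingProperties ring using (-‿distribˡ-*; -‿involutive)
  open AbelianGroupProperties +-abelianGroup using (//-rightDividesˡ)

  <⇒≱ : ∀ {x y} → x <ᵣ y → ¬ (y ≤ x)
  <⇒≱ = ToStrict.<⇒≱ _≈_ _≤_ antisym

  +-monoˡ-≤ : ∀ z {x y} → x ≤ y → x + z ≤ y + z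
  +-monoˡ-≤ z {x} {y} x≤y = begin
    x + z ≈⟨ +-comm x z ⟩
    z + x ≤⟨ +-monoʳ-≤ z x≤y ⟩
    z + y ≈⟨ +-comm z y ⟩
    y + z ∎

  +-mono-≤ : ∀ {x y u v} → x ≤ y → u ≤ v → x + u ≤ y + v
  +-mono-≤ {y = y} {u} x≤y u≤v = ≤-trans (+-monoˡ-≤ u x≤y) (+-monoʳ-≤ y u≤v)

  x-y+y≈x : ∀ x y → (x - y) + y ≈ x
  x-y+y≈x x y = //-rightDividesˡ y x

  +-cancelˡ-≤ : ∀ z {x y} → z + x ≤ z + y → x ≤ y
  +-cancelˡ-≤ z {x} {y} z+x≤z+y = begin
    x             ≈⟨ -z+[z+t]≈t x ⟨
    - z + (z + x) ≤⟨ +-monoʳ-≤ (- z) z+x≤z+y ⟩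
    - z + (z + y) ≈⟨ -z+[z+t]≈t y ⟩
    y             ∎
    where
    -z+[z+t]≈t : ∀ t → - z + (z + t) ≈ t
    -z+[z+t]≈t t = begin-equality
      - z + (z + t) ≈⟨ +-assoc (- z) z t ⟨
      (- z + z) + t ≈⟨ +-congʳ (-‿inverseˡ z) ⟩
      0# + t        ≈⟨ +-identityˡ t ⟩
      t             ∎

  x-y≤z⇒x≤z+y : ∀ {x y z} → x - y ≤ z → x ≤ z + y
  x-y≤z⇒x≤z+y {x} {y} {z} x-y≤z = begin
    x           ≈⟨ x-y+y≈x x y ⟨
    (x - y) + y ≤⟨ +-monoˡ-≤ y x-y≤z ⟩
    z + y       ∎

  x≤z+y⇒x-y≤z : ∀ {x y z} → x ≤ z + y → x - y ≤ z
  x≤z+y⇒x-y≤z {x} {y} {z} x≤z+y = +-cancelˡ-≤ y (begin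
    y + (x - y) ≈⟨ +-comm y (x - y) ⟩
    (x - y) + y ≈⟨ x-y+y≈x x y ⟩
    x           ≤⟨ x≤z+y ⟩
    z + y       ≈⟨ +-comm z y ⟩
    y + z       ∎)

  x≤0⇒0≤-x : ∀ {x} → x ≤ 0# → 0# ≤ - x
  x≤0⇒0≤-x {x} x≤0 = +-cancelˡ-≤ x (begin
    x + 0#  ≈⟨ +-identityʳ x ⟩
    x       ≤⟨ x≤0 ⟩
    0#      ≈⟨ -‿inverseʳ x ⟨
    x + - x ∎)

  -- The axiom `*-nonNegative`, applied to `z` and `y - x`, makes the gap `z * (y - x)` nonnegative;
  -- adding `z * x` gives the claim.
  *-monoˡ-≤ : ∀ {z} → 0# ≤ z → ∀ {x y} → x ≤ y → z * x ≤ z * y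
  *-monoˡ-≤ {z} 0≤z {x} {y} x≤y = begin
    z * x                    ≈⟨ +-identityˡ (z * x) ⟨
    0# + z * x               ≤⟨ +-monoˡ-≤ (z * x) (*-nonNegative 0≤z 0≤y-x) ⟩
    z * (y - x) + z * x      ≈⟨ distribˡ z (y - x) x ⟨
    z * ((y - x) + x)        ≈⟨ *-congˡ (x-y+y≈x y x) ⟩
    z * y                    ∎
    where
    0≤y-x : 0# ≤ y - x
    0≤y-x = +-cancelˡ-≤ x (begin
      x + 0#      ≈⟨ +-identityʳ x ⟩
      x           ≤⟨ x≤y ⟩
      y           ≈⟨ x-y+y≈x y x ⟨
      (y - x) + x ≈⟨ +-comm (y - x) x ⟩
      x + (y - x) ∎)

  *-monoʳ-≤ : ∀ {z} → 0# ≤ z → ∀ {x y} → x ≤ y → x * z ≤ y * z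
  *-monoʳ-≤ {z} 0≤z {x} {y} x≤y = begin
    x * z ≈⟨ *-comm x z ⟩
    z * x ≤⟨ *-monoˡ-≤ 0≤z x≤y ⟩
    z * y ≈⟨ *-comm z y ⟩
    y * z ∎

  -- By totality the alternative is `1# ≤ 0#`; then `- 1#` is nonnegative, and so is its square,
  -- which is `1#`.
  0≤1 : 0# ≤ 1#
  0≤1 with total 0# 1#
  ... | inj₁ 0≤1 = 0≤1
  ... | inj₂ 1≤0 = begin
    0#            ≤⟨ *-nonNegative (x≤0⇒0≤-x 1≤0) (x≤0⇒0≤-x 1≤0) ⟩
    - 1# * - 1#   ≈⟨ -‿distribˡ-* 1# (- 1#) ⟨
    - (1# * - 1#) ≈⟨ -‿cong (*-identityˡ (- 1#)) ⟩
    - (- 1#)      ≈⟨ -‿involutive 1# ⟩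
    1#            ∎

  0<1 : 0# <ᵣ 1#
  0<1 = 0≤1 , 0≉1

  1≤x⇒0<x : ∀ {x} → 1# ≤ x → 0# <ᵣ x
  1≤x⇒0<x {x} 1≤x = begin-strict
    0# <⟨ 0<1 ⟩
    1# ≤⟨ 1≤x ⟩
    x  ∎

  0<x⇒x*x⁻¹≈1 : ∀ {x} → 0# <ᵣ x → x * x ⁻¹ ≈ 1#
  0<x⇒x*x⁻¹≈1 {x} (_ , 0≉x) = ⁻¹-inverse x (λ x≈0 → 0≉x (sym x≈0))

  -- If `x ⁻¹` were at most zero, multiplying by `x` would give `1# ≤ 0#`.
  0<x⇒0≤x⁻¹ : ∀ {x} → 0# <ᵣ x → 0# ≤ x ⁻¹
  0<x⇒0≤x⁻¹ {x} 0<x with total 0# (x ⁻¹)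
  ... | inj₁ 0≤x⁻¹ = 0≤x⁻¹
  ... | inj₂ x⁻¹≤0 = ⊥-elim (<⇒≱ 0<1 (begin
    1#       ≈⟨ 0<x⇒x*x⁻¹≈1 0<x ⟨
    x * x ⁻¹ ≤⟨ *-monoˡ-≤ (proj₁ 0<x) x⁻¹≤0 ⟩
    x * 0#   ≈⟨ zeroʳ x ⟩
    0#       ∎))

  [x/y]*y≈x : ∀ x {y} → 0# <ᵣ y → (x / y) * y ≈ x
  [x/y]*y≈x x {y} 0<y = begin-equality
    (x * y ⁻¹) * y ≈⟨ *-assoc x (y ⁻¹) y ⟩
    x * (y ⁻¹ * y) ≈⟨ *-congˡ (*-comm (y ⁻¹) y) ⟩
    x * (y * y ⁻¹) ≈⟨ *-congˡ (0<x⇒x*x⁻¹≈1 0<y) ⟩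
    x * 1#         ≈⟨ *-identityʳ x ⟩
    x              ∎

  x/y≤z⇒x≤z*y : ∀ {x y z} → 0# <ᵣ y → x / y ≤ z → x ≤ z * y
  x/y≤z⇒x≤z*y {x} {y} {z} 0<y x/y≤z = begin
    x           ≈⟨ [x/y]*y≈x x 0<y ⟨
    (x / y) * y ≤⟨ *-monoʳ-≤ (proj₁ 0<y) x/y≤z ⟩
    z * y       ∎

  x≤z*y⇒x/y≤z : ∀ {x y z} → 0# <ᵣ y → x ≤ z * y → x / y ≤ z
  x≤z*y⇒x/y≤z {x} {y} {z} 0<y x≤z*y = begin
    x * y ⁻¹       ≤⟨ *-monoʳ-≤ (0<x⇒0≤x⁻¹ 0<y) x≤z*y ⟩
    (z * y) * y ⁻¹ ≈⟨ *-assoc z y (y ⁻¹) ⟩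
    z * (y * y ⁻¹) ≈⟨ *-congˡ (0<x⇒x*x⁻¹≈1 0<y) ⟩
    z * 1#         ≈⟨ *-identityʳ z ⟩
    z              ∎

  1≤2 : 1# ≤ 2#
  1≤2 = begin
    1#      ≈⟨ +-identityʳ 1# ⟨
    1# + 0# ≤⟨ +-monoʳ-≤ 1# 0≤1 ⟩
    2#      ∎

  1≤4 : 1# ≤ 4#
  1≤4 = begin
    1#      ≤⟨ 1≤2 ⟩
    2#      ≈⟨ +-identityʳ 2# ⟨
    2# + 0# ≤⟨ +-monoʳ-≤ 2# (≤-trans 0≤1 1≤2) ⟩
    4#      ∎

-- The two graphs and their matchings.

module TwoEdgeGraphs {c ℓ₁ ℓ₂ : Level} (ℝ : RealNumbers c ℓ₁ ℓ₂) where
  open RealNumbers ℝ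
  open WeightedGraphs ℝ
  open OrderedField ℝ
  open PartialOrderReasoning poset
  open Extrema totalOrder using (max≤v⁺; v≤max⁺)
  open SemiringSolver commutativeSemiring

  totalWeight≤μ : ∀ {G M} → M ∈ matchings G → totalWeight M ≤ μ G
  totalWeight≤μ {G} M∈ =
    v≤max⁺ 0# (map totalWeight (matchings G)) (inj₂ (Any.map⁺ (lose M∈ ≤-refl)))

  -- The hypothesis `0# ≤ v` covers the default value `0#` from which the maximum starts.
  μ≤v : ∀ {G v} → 0# ≤ v → All (λ M → totalWeight M ≤ v) (matchings G) → μ G ≤ v
  μ≤v {G} 0≤v ≤v = max≤v⁺ {xs = map totalWeight (matchings G)} 0≤v (All.map⁺ ≤v)

  module _ (w : Carrier) (1≤w : 1# ≤ w) where

    edge₀₁ edge₁₂ edge₂₃ : Edge 4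
    edge₀₁ = record { src = 0F ; tgt = 1F ; src<tgt = s≤s z≤n
                    ; weight = 1# ; positive = 0<1 }
    edge₁₂ = record { src = 1F ; tgt = 2F ; src<tgt = s≤s (s≤s z≤n)
                    ; weight = w ; positive = 1≤x⇒0<x 1≤w }
    edge₂₃ = record { src = 2F ; tgt = 3F ; src<tgt = s≤s (s≤s (s≤s z≤n))
                    ; weight = w ; positive = 1≤x⇒0<x 1≤w }

    -- The graphs differ only in whether the edge of weight `w` meets `edge₀₁`, at vertex `1F`. In
    -- `path` the vertex `3F` is isolated.
    twoEdges path : WeightedGraph
    twoEdges = record
      { order  = 4
      ; edges  = edge₀₁ ∷ edge₂₃ ∷ []
      ; simple = ((λ { (() , _) }) ∷ []) ∷ [] ∷ []
      }
    path = record
      { order  = 4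
      ; edges  = edge₀₁ ∷ edge₁₂ ∷ []
      ; simple = ((λ { (() , _) }) ∷ []) ∷ [] ∷ []
      }

    0≤w : 0# ≤ w
    0≤w = ≤-trans 0≤1 1≤w

    w+1≤μ-twoEdges : w + 1# ≤ μ twoEdges
    w+1≤μ-twoEdges = begin
      w + 1#        ≈⟨ +-comm w 1# ⟩
      1# + w        ≈⟨ +-congˡ (+-identityʳ w) ⟨
      -- The full edge set is a matching; `sublists` lists it last, after the empty set and the two
      -- singletons.
      1# + (w + 0#) ≤⟨ totalWeight≤μ {twoEdges} {edge₀₁ ∷ edge₂₃ ∷ []} (there (there (there (here ≡.refl)))) ⟩
      μ twoEdges    ∎

    -- The upper bound is for the error term `ε * μ twoEdges` of an approximation.
    μ-twoEdges≤w+1 : μ twoEdges ≤ w + 1#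
    μ-twoEdges≤w+1 = μ≤v {twoEdges} 0≤w+1 (0≤w+1 ∷ +-monoʳ-≤ w 0≤1 ∷ 1+0≤w+1 ∷ ≤-reflexive 1+[w+0]≈w+1 ∷ [])
      where
      0≤w+1 : 0# ≤ w + 1#
      0≤w+1 = begin
        0#      ≈⟨ +-identityˡ 0# ⟨
        0# + 0# ≤⟨ +-mono-≤ 0≤w 0≤1 ⟩
        w + 1#  ∎
      1+0≤w+1 : 1# + 0# ≤ w + 1#
      1+0≤w+1 = +-mono-≤ 1≤w 0≤1
      1+[w+0]≈w+1 : 1# + (w + 0#) ≈ w + 1#
      1+[w+0]≈w+1 = begin-equality
        1# + (w + 0#) ≈⟨ +-congˡ (+-identityʳ w) ⟩
        1# + w        ≈⟨ +-comm 1# w ⟩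
        w + 1#        ∎

    -- The shared vertex `1F` rules out the pair of edges, which leaves the empty matching and two
    -- singletons; by `1≤w` none weighs more than `w`.
    μ-path≤w : μ path ≤ w
    μ-path≤w = μ≤v {path} 0≤w (0≤w ∷ ≤-reflexive (+-identityʳ w) ∷ 1+0≤w ∷ [])
      where
      1+0≤w : 1# + 0# ≤ w
      1+0≤w = ≤-trans (≤-reflexive (+-identityʳ 1#)) 1≤w

    -- The tests on w only surface once the filter has decided edge₀₁, hence the nested case split.
    μ-agree : (J : Interval) →
              ¬ (WeightIn J edge₀₁ × WeightIn J edge₂₃) →
              μ (twoEdges [ J ]) ≈ μ (path [ J ])
    μ-agree J notBoth with lo J ≤? 1# | 1# ≤? hi J
    ... | yes lo≤1 | yes 1≤hi with lo J ≤? w | w ≤? hi J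
    ...   | yes lo≤w | yes w≤hi = ⊥-elim (notBoth ((lo≤1 , 1≤hi) , (lo≤w , w≤hi)))
    -- In this and the remaining cases the same weights survive in both graphs, at most one of them,
    -- so both maxima reduce to the same term.
    ...   | yes _    | no  _    = refl
    ...   | no  _    | _        = refl
    μ-agree J notBoth | yes _ | no _ with lo J ≤? w | w ≤? hi J
    ...   | yes _ | yes _ = refl
    ...   | yes _ | no  _ = refl
    ...   | no  _ | _     = refl
    μ-agree J notBoth | no _  | _    with lo J ≤? w | w ≤? hi J
    ...   | yes _ | yes _ = refl
    ...   | yes _ | no  _ = refl
    ...   | no  _ | _     = refl

    -- The value `ν` links the two maxima: `μ twoEdges` is at most `ν` plus its error, and `ν` is at
    -- most `μ path` plus its error. Hence the gap of `1#` is at most the sum of the errors,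
    -- `ε * (w + 1#)` and `ε * w`.
    commonApproximation⇒1≤[2w+1]ε : ∀ {ε ν} → 0# ≤ ε →
                          Approximates ε ν (μ twoEdges) → Approximates ε ν (μ path) →
                          1# ≤ ((w + w) + 1#) * ε
    commonApproximation⇒1≤[2w+1]ε {ε} {ν} 0≤ε ν≈y ν≈x = +-cancelˡ-≤ w (begin
      w + 1#                            ≤⟨ w+1≤μ-twoEdges ⟩
      μ twoEdges                        ≤⟨ y≤εy+ν ⟩
      ε * μ twoEdges + ν                ≤⟨ +-mono-≤ (*-monoˡ-≤ 0≤ε μ-twoEdges≤w+1) ν≤εx+x ⟩
      ε * (w + 1#) + (ε * μ path + μ path)
        ≤⟨ +-monoʳ-≤ (ε * (w + 1#)) (+-mono-≤ (*-monoˡ-≤ 0≤ε μ-path≤w) μ-path≤w) ⟩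
      ε * (w + 1#) + (ε * w + w)
        ≈⟨ solve 2 (λ e x → e :* (x :+ con 1) :+ (e :* x :+ x) := x :+ ((x :+ x) :+ con 1) :* e) refl ε w ⟩
      w + ((w + w) + 1#) * ε            ∎)
      where
      open Max totalOrder using (x⊔y≤z⇒x≤z; x⊔y≤z⇒y≤z)
      open AbelianGroupProperties +-abelianGroup using (⁻¹-anti-homo‿-)
      -- As `abs` is the maximum of a number and its negative, each approximation gives two
      -- one-sided bounds; here the upper one, and below the lower one for `μ twoEdges`.
      ν≤εx+x : ν ≤ ε * μ path + μ path
      ν≤εx+x = x-y≤z⇒x≤z+y (x⊔y≤z⇒x≤z _ _ ν≈x)
      y≤εy+ν : μ twoEdges ≤ ε * μ twoEdges + ν
      y≤εy+ν = x-y≤z⇒x≤z+y (begin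
        μ twoEdges - ν     ≈⟨ ⁻¹-anti-homo‿- ν (μ twoEdges) ⟨
        - (ν - μ twoEdges) ≤⟨ x⊔y≤z⇒y≤z (ν - μ twoEdges) _ ν≈y ⟩
        ε * μ twoEdges     ∎)

-- The choice of `w` and the bound on `R`.

lemma2p5 : {c ℓ₁ ℓ₂ i : Level} (ℝ : RealNumbers c ℓ₁ ℓ₂) →
    let open RealNumbers ℝ
        open WeightedGraphs ℝ
    in
    (ε : Carrier) → 0# <ᵣ ε → ε <ᵣ 1# / 2# →
    (R : Carrier) → 1# ≤ R → R <ᵣ (ε ⁻¹ - 1#) / 4# →
    ∃ λ (G : WeightedGraph) → ∃ λ (G′ : WeightedGraph) →
      {ι : Set i} (I : ι → Interval) →
      (∀ k → hi (I k) / lo (I k) ≤ R) →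
      (∀ k → μ (G [ I k ]) ≈ μ (G′ [ I k ])) ×
      ¬ (∃ λ ν → Approximates ε ν (μ G) × Approximates ε ν (μ G′))
lemma2p5 ℝ ε 0<ε _ R 1≤R R<[ε⁻¹-1]/4 =
  twoEdges w 1≤w , path w 1≤w , λ I narrow →
    (λ k → μ-agree w 1≤w (I k) (notBoth (I k) (narrow k))) ,
    λ (_ , ν≈y , ν≈x) →
      <⇒≱ R<[ε⁻¹-1]/4 (1≤[2w+1]ε⇒[ε⁻¹-1]/4≤R (commonApproximation⇒1≤[2w+1]ε w 1≤w (proj₁ 0<ε) ν≈y ν≈x))
  where
  open RealNumbers ℝ
  open WeightedGraphs ℝ
  open OrderedField ℝ
  open TwoEdgeGraphs ℝ
  open PartialOrderReasoning poset
  open SemiringSolver commutativeSemiring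

  w : Carrier
  w = R + R

  0<R : 0# <ᵣ R
  0<R = 1≤x⇒0<x 1≤R

  1≤w : 1# ≤ w
  1≤w = begin
    1#      ≤⟨ 1≤R ⟩
    R       ≈⟨ +-identityʳ R ⟨
    R + 0#  ≤⟨ +-monoʳ-≤ R (proj₁ 0<R) ⟩
    R + R   ∎

  -- From `lo J ≤ 1#` the ratio bound yields `hi J ≤ R`, while `w ≤ hi J` with `w = R + R`;
  -- cancelling `R` contradicts `0<R`.
  notBoth : (J : Interval) → hi J / lo J ≤ R → ¬ ((lo J ≤ 1# × 1# ≤ hi J) × (lo J ≤ w × w ≤ hi J))
  notBoth J narrow ((lo≤1 , _) , (_ , w≤hi)) = <⇒≱ 0<R (+-cancelˡ-≤ R (begin
    R + R    ≤⟨ w≤hi ⟩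
    hi J     ≤⟨ x/y≤z⇒x≤z*y (0<lo J) narrow ⟩
    R * lo J ≤⟨ *-monoˡ-≤ (proj₁ 0<R) lo≤1 ⟩
    R * 1#   ≈⟨ *-identityʳ R ⟩
    R        ≈⟨ +-identityʳ R ⟨
    R + 0#   ∎))

  -- Dividing by `ε` gives `ε ⁻¹ ≤ R * 4# + 1#`, since `w + w` is four times `R`; this negates the
  -- strict upper bound assumed on `R`.
  1≤[2w+1]ε⇒[ε⁻¹-1]/4≤R : 1# ≤ ((w + w) + 1#) * ε → (ε ⁻¹ - 1#) / 4# ≤ R
  1≤[2w+1]ε⇒[ε⁻¹-1]/4≤R 1≤[2w+1]ε =
    x≤z*y⇒x/y≤z (1≤x⇒0<x 1≤4) (x≤z+y⇒x-y≤z (begin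
      ε ⁻¹          ≈⟨ *-identityˡ (ε ⁻¹) ⟨
      1# / ε        ≤⟨ x≤z*y⇒x/y≤z 0<ε 1≤[2w+1]ε ⟩
      (w + w) + 1#
        ≈⟨ solve 1 (λ r → (r :+ r) :+ (r :+ r) :+ con 1 := r :* ((con 1 :+ con 1) :+ (con 1 :+ con 1)) :+ con 1) refl R ⟩
      R * 4# + 1#   ∎))
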